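{- Let $G$ be a finite, simple, connected graph of order $n\ge 2$. Then $\dim_{wt}(G)=n$ if and only if every vertex of $G$ is a twin.
   Context: $d(x,y)$ is the shortest-path distance and $N(x)$ the set of neighbors of $x$. A set $W\subseteq V(G)$ is a resolving set if for every two distinct vertices $y,z$ there is $x\in W$ with $d(y,x)\ne d(z,x)$. A set $W$ is a weak total resolving set (WTR-set) if $W$ is resolving and, for every $w\in W$ and every $x\in V(G)\setminus W$, there is $w'\in W\setminus\{w\}$ with $d(x,w')\ne d(w,w')$. $\dim_{wt}(G)$ is the minimum cardinality of a WTR-set. Two distinct vertices $u,v$ are twins if $N(u)\setminus\{v\}=N(v)\setminus\{u\}$; a vertex $u$ is a twin if there exists $v\ne u$ such that $u,v$ are twins. -}

module Defs where

open import Data.Fin.Base using (Fin)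
open import Data.Fin.Properties using (_≟_; any?; all?)
open import Data.Fin.Subset using (Subset; _∈_; _∉_; _-_; ∣_∣; ⊤)
open import Data.Fin.Subset.Properties using (_∈?_; anySubset?; ∈⊤; ∣⊤∣≡n)
open import Data.List.Base using (List; []; _∷_)
open import Data.List.Relation.Unary.Unique.Propositional using (Unique)
open import Data.List.Relation.Unary.Unique.DecPropositional using (unique?)
open import Data.Nat.Base using (ℕ; zero; suc; _≤_; z≤n; s≤s)
import Data.Nat.Properties as ℕ
open import Data.Product.Base using (∃; _×_; _,_; proj₁; proj₂)
open import Data.Vec.Base using (tabulate)
open import Level using (0ℓ)
open import Relation.Binary.Core using (Rel)
import Relation.Binary.Definitions as B
open import Relation.Binary.PropositionalEquality
  using (_≡_; _≢_; refl; sym; trans; subst)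
open import Relation.Nullary.Decidable.Core
  using (Dec; yes; no; does; map′; ¬?; _×-dec_; _→-dec_)
open import Relation.Nullary.Negation.Core using (contradiction)
open import Relation.Unary using (Pred; Decidable)

IsMinimum : Pred ℕ 0ℓ → ℕ → Set
IsMinimum P k = P k × (∀ m → P m → k ≤ m)

minimum : ∀ {P : Pred ℕ 0ℓ} → Decidable P → ∀ k → P k → ∃ (IsMinimum P)
minimum P? zero p = zero , p , λ _ _ → z≤n
minimum {P} P? (suc k) p with P? zero
... | yes p₀ = zero , p₀ , λ _ _ → z≤n
... | no ¬p₀ with minimum {λ i → P (suc i)} (λ i → P? (suc i)) k p
...   | l , pl , l-least = suc l , pl , λ where
          zero    p₀ → contradiction p₀ ¬p₀
          (suc m) pm → s≤s (l-least m pm)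

-- Finite simple graphs of order n.  Decidability of adjacency is automatic
-- classically; here it makes neighbourhoods and distances computable.
record Graph (n : ℕ) : Set₁ where
  infix 4 _~_ _~?_
  field
    _~_      : Rel (Fin n) 0ℓ
    _~?_     : B.Decidable _~_
    ~-sym    : B.Symmetric _~_
    ~-irrefl : B.Irreflexive _≡_ _~_

module _ {n : ℕ} (G : Graph n) where
  open Graph G

  N : Fin n → Subset n
  N u = tabulate (λ v → does (u ~? v))

  Twins : Rel (Fin n) 0ℓ
  Twins u v = u ≢ v × N u - v ≡ N v - u

  IsTwin : Pred (Fin n) 0ℓ
  IsTwin u = ∃ λ v → Twins u v

  -- Walks indexed by their end points and their number of edges.
  data Walk : Fin n → Fin n → ℕ → Set where
    []  : ∀ {x} → Walk x x zero
    _∷_ : ∀ {x y z k} → x ~ y → Walk y z k → Walk x z (suc k)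

  vertices : ∀ {x y k} → Walk x y k → List (Fin n)
  vertices {x} []      = x ∷ []
  vertices {x} (_ ∷ w) = x ∷ vertices w

  Path : Fin n → Fin n → ℕ → Set
  Path x y k = ∃ λ (w : Walk x y k) → Unique (vertices w)

  Connected : Set
  Connected = ∀ x y → ∃ (Path x y)

  walk? : ∀ {P : Pred (List (Fin n)) 0ℓ} → Decidable P →
          ∀ x y k → Dec (∃ λ (w : Walk x y k) → P (vertices w))
  walk? P? x y zero with x ≟ y
  ... | no x≢y   = no λ where ([] , _) → x≢y refl
  ... | yes refl = map′ ([] ,_) (λ where ([] , p) → p) (P? (x ∷ []))
  walk? P? x y (suc k) =
    map′ (λ where (z , a , w , p) → a ∷ w , p)
         (λ where (a ∷ w , p) → _ , a , w , p)
         (any? λ z → (x ~? z) ×-dec walk? (λ vs → P? (x ∷ vs)) z y k)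

  path? : ∀ x y → Decidable (Path x y)
  path? x y = walk? (unique? _≟_) x y

module _ {n : ℕ} (G : Graph n) (connected : Connected G) where

  dist-minimum : ∀ x y → ∃ (IsMinimum (Path G x y))
  dist-minimum x y = let k , p = connected x y in minimum (path? G x y) k p

  dist : Fin n → Fin n → ℕ
  dist x y = proj₁ (dist-minimum x y)

  dist-refl : ∀ x → dist x x ≡ 0
  dist-refl x = ℕ.n≤0⇒n≡0 (proj₂ (proj₂ (dist-minimum x x)) 0 trivial)
    where
    open import Data.List.Relation.Unary.All using ([])
    open import Data.List.Relation.Unary.AllPairs using ([]; _∷_)
    trivial : Path G x x 0
    trivial = [] , [] ∷ []

  dist≡0⇒≡ : ∀ {x y} → dist x y ≡ 0 → x ≡ y
  dist≡0⇒≡ {x} {y} d≡0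
    with subst (Path G x y) d≡0 (proj₁ (proj₂ (dist-minimum x y)))
  ... | [] , _ = refl

  Resolving : Pred (Subset n) 0ℓ
  Resolving W = ∀ y z → y ≢ z → ∃ λ x → x ∈ W × dist y x ≢ dist z x

  WeakTotalResolving : Pred (Subset n) 0ℓ
  WeakTotalResolving W =
    Resolving W ×
    (∀ w x → w ∈ W → x ∉ W → ∃ λ w′ → w′ ∈ W - w × dist x w′ ≢ dist w w′)

  resolving? : Decidable Resolving
  resolving? W =
    all? λ y → all? λ z → ¬? (y ≟ z) →-dec
      any? λ x → (x ∈? W) ×-dec ¬? (dist y x ℕ.≟ dist z x)

  weakTotalResolving? : Decidable WeakTotalResolving
  weakTotalResolving? W =
    resolving? W ×-dec
    (all? λ w → all? λ x → (w ∈? W) →-dec ¬? (x ∈? W) →-dec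
      any? λ w′ → (w′ ∈? (W - w)) ×-dec ¬? (dist x w′ ℕ.≟ dist w w′))

  ⊤-weakTotalResolving : WeakTotalResolving ⊤
  ⊤-weakTotalResolving =
    (λ y z y≢z → y , ∈⊤ , λ eq →
      y≢z (sym (dist≡0⇒≡ (trans (sym eq) (dist-refl y))))) ,
    (λ w x _ x∉⊤ → contradiction ∈⊤ x∉⊤)

  WTRCardinality : Pred ℕ 0ℓ
  WTRCardinality k = ∃ λ W → WeakTotalResolving W × ∣ W ∣ ≡ k

  wtrCardinality? : Decidable WTRCardinality
  wtrCardinality? k =
    anySubset? λ W → weakTotalResolving? W ×-dec (∣ W ∣ ℕ.≟ k)

  dim-wt-minimum : ∃ (IsMinimum WTRCardinality)
  dim-wt-minimum =
    minimum wtrCardinality? n (⊤ , ⊤-weakTotalResolving , ∣⊤∣≡n n)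

  dim-wt : ℕ
  dim-wt = proj₁ dim-wt-minimum

{-# OPTIONS --safe #-}

-- Vertices u ≢ v are twins iff they have equal distances to every other
-- vertex: a shortest path from v yields a path from u of no greater length,
-- either its part starting at u or, if it avoids u, the path with v replaced
-- by u; conversely, adjacency means distance 1.
-- Hence a WTR-set W cannot omit a vertex x with a twin v: only v could
-- resolve the pair x, v, so v ∈ W, and then the weak total condition for v
-- and x fails.  If u is not a twin then ⊤ - u is a WTR-set, so dim-wt < n.

module Submission where

open import Defs
import Data.Bool.Properties as Bool
open import Data.Fin.Base using (Fin; suc)
open import Data.Fin.Properties using (_≟_; any?)
open import Data.Fin.Subset using (Subset; _∈_; _∉_; _⊆_; _-_; ∣_∣; ⊤; ⁅_⁆)
open import Data.Fin.Subset.Properties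
  using (_∈?_; ∈⊤; ∣⊤∣≡n; ⊆-antisym; p─q⊆p; x∈p∧x≢y⇒x∈p-y; x∈p⇒∣p-x∣<∣p∣;
         p⊆q⇒∣p∣≤∣q∣)
import Data.List.Membership.Propositional as List
import Data.List.Membership.DecPropositional as DecMembership
open import Data.List.Relation.Unary.All.Properties using (¬Any⇒All¬)
open import Data.List.Relation.Unary.All using ([]; _∷_)
open import Data.List.Relation.Unary.AllPairs using ([]; _∷_)
open import Data.List.Relation.Unary.Any using (here; there)
open import Data.List.Relation.Unary.Unique.Propositional using (Unique)
open import Data.Nat.Base using (ℕ; _≤_; _<_)
import Data.Nat.Properties as ℕ
open import Data.Product.Base using (∃; _×_; _,_; proj₁; proj₂)
open import Data.Vec.Base using (_∷_; there)
open import Data.Vec.Properties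
  using (≡-dec; []=⇒lookup; lookup⇒[]=; lookup∘tabulate)
open import Function.Bundles using (_⇔_; mk⇔)
open import Relation.Binary.PropositionalEquality
  using (_≡_; _≢_; refl; sym; trans; subst; ≢-sym)
import Relation.Binary.Definitions as B
open import Relation.Nullary.Decidable
  using (yes; no; does; dec-true; ¬?; _×-dec_; decidable-stable)
open import Relation.Nullary.Negation using (¬_; contradiction)
open import Relation.Unary using (Decidable)

x∉p-x : ∀ {n} (p : Subset n) x → x ∉ p - x
x∉p-x (_ ∷ p) (suc x) (there x∈) = x∉p-x p x x∈

x∈p-y⇒x≢y : ∀ {n} {p : Subset n} {x y} → x ∈ p - y → x ≢ y
x∈p-y⇒x≢y {p = p} {x} x∈ refl = x∉p-x p x x∈

x∈p-y⇒x∈p : ∀ {n} {p : Subset n} {x y} → x ∈ p - y → x ∈ p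
x∈p-y⇒x∈p {p = p} {y = y} = p─q⊆p p ⁅ y ⁆

x∉⊤-y⇒x≡y : ∀ {n} {x y : Fin n} → x ∉ ⊤ - y → x ≡ y
x∉⊤-y⇒x≡y {x = x} {y} x∉ =
  decidable-stable (x ≟ y) λ x≢y → x∉ (x∈p∧x≢y⇒x∈p-y ∈⊤ x≢y)

module _ {n : ℕ} (G : Graph n) where
  open Graph G

  ∈N⁺ : ∀ {u v} → u ~ v → v ∈ N G u
  ∈N⁺ {u} {v} u~v = lookup⇒[]= v _
    (trans (lookup∘tabulate _ v) (dec-true (u ~? v) u~v))

  ∈N⁻ : ∀ {u v} → v ∈ N G u → u ~ v
  ∈N⁻ {u} {v} v∈N
    with u ~? v | trans (sym (lookup∘tabulate (λ x → does (u ~? x)) v)) ([]=⇒lookup v∈N)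
  ... | yes u~v | _  = u~v
  ... | no  _   | ()

  twins-sym : B.Symmetric (Twins G)
  twins-sym (u≢v , eq) = ≢-sym u≢v , sym eq

  -- Decidability makes the forward direction of the theorem constructive: refuting `¬ IsTwin G u`
  -- yields an actual twin of `u`.
  isTwin? : Decidable (IsTwin G)
  isTwin? u = any? λ v → ¬? (u ≟ v) ×-dec ≡-dec Bool._≟_ (N G u - v) (N G v - u)

  twins-~ : ∀ {u v y} → Twins G u v → y ≢ u → v ~ y → u ~ y
  twins-~ {y = y} (_ , eq) y≢u v~y =
    ∈N⁻ (x∈p-y⇒x∈p (subst (y ∈_) (sym eq) (x∈p∧x≢y⇒x∈p-y (∈N⁺ v~y) y≢u)))

  start∈vertices : ∀ {x y k} (w : Walk G x y k) → x List.∈ vertices G w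
  start∈vertices []      = here refl
  start∈vertices (_ ∷ _) = here refl

  suffix : ∀ {x y z k} (w : Walk G y z k) → Unique (vertices G w) →
           x List.∈ vertices G w → ∃ λ j → j ≤ k × Path G x z j
  suffix w@[]      uniq       (here refl) = _ , ℕ.≤-refl , w , uniq
  suffix w@(_ ∷ _) uniq       (here refl) = _ , ℕ.≤-refl , w , uniq
  suffix (_ ∷ w)   (_ ∷ uniq) (there x∈w) =
    let j , j≤k , p = suffix w uniq x∈w in j , ℕ.m≤n⇒m≤1+n j≤k , p

  twins-path : ∀ {u v z k} → Twins G u v → z ≢ v → Path G v z k →
               ∃ λ j → j ≤ k × Path G u z j
  twins-path _ z≢v ([] , _) = contradiction refl z≢v
  twins-path {u} t z≢v (v~y ∷ w , _ ∷ uniq)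
    with DecMembership._∈?_ _≟_ u (vertices G w)
  -- The tail may already meet `u`, for instance when `z` is `u`; starting there drops at least the
  -- edge `v~y`.
  ... | yes u∈w = let j , j≤k , p = suffix w uniq u∈w in j , ℕ.m≤n⇒m≤1+n j≤k , p
  -- Avoiding `u` keeps the new path simple and also gives `y ≢ u`, which moving the first edge from
  -- `v` to `u` requires.
  ... | no  u∉w = _ , ℕ.≤-refl , twins-~ t y≢u v~y ∷ w , ¬Any⇒All¬ _ u∉w ∷ uniq
    where
    y≢u : _ ≢ u
    y≢u refl = u∉w (start∈vertices w)

module _ {n : ℕ} (G : Graph n) (connected : Connected G) where
  open Graph G

  private
    d : Fin n → Fin n → ℕ
    d = dist G connected

  dist-path : ∀ x y → Path G x y (d x y)
  dist-path x y = proj₁ (proj₂ (dist-minimum G connected x y))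

  dist-least : ∀ {x y k} → Path G x y k → d x y ≤ k
  dist-least = proj₂ (proj₂ (dist-minimum G connected _ _)) _

  -- Only `x` is at distance 0 from `x`, so a vertex of a set resolves itself from all others.
  dist-separates : ∀ {x y} → x ≢ y → d x x ≢ d y x
  dist-separates {x} x≢y eq = x≢y
    (sym (dist≡0⇒≡ G connected (trans (sym eq) (dist-refl G connected x))))

  ~⇒dist≡1 : ∀ {x y} → x ~ y → d x y ≡ 1
  ~⇒dist≡1 x~y = ℕ.≤-antisym
    (dist-least (x~y ∷ [] , (x≢y ∷ []) ∷ [] ∷ []))
    (ℕ.n≢0⇒n>0 λ d≡0 → x≢y (dist≡0⇒≡ G connected d≡0))
    where
    x≢y : _ ≢ _
    x≢y x≡y = ~-irrefl x≡y x~y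

  dist≡1⇒~ : ∀ {x y} → d x y ≡ 1 → x ~ y
  dist≡1⇒~ {x} {y} d≡1 with subst (Path G x y) d≡1 (dist-path x y)
  ... | x~y ∷ [] , _ = x~y

  twins⇒dist≤ : ∀ {u v z} → Twins G u v → z ≢ v → d u z ≤ d v z
  twins⇒dist≤ {v = v} {z} t z≢v =
    let _ , j≤d , p = twins-path G t z≢v (dist-path v z)
    in ℕ.≤-trans (dist-least p) j≤d

  twins⇒dist≡ : ∀ {u v z} → Twins G u v → z ≢ u → z ≢ v → d u z ≡ d v z
  twins⇒dist≡ t z≢u z≢v =
    ℕ.≤-antisym (twins⇒dist≤ t z≢v) (twins⇒dist≤ (twins-sym G t) z≢u)

  -- Adjacency is distance 1, and a neighbour of `u` other than `v` is a third vertex, so the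
  -- hypothesis carries that distance over to `v`. Exchanging `u` and `v` gives the reverse
  -- inclusion.
  dist≡⇒N-⊆ : ∀ {u v} → (∀ z → z ≢ u → z ≢ v → d u z ≡ d v z) →
              N G u - v ⊆ N G v - u
  dist≡⇒N-⊆ {u} {v} d≡ {z} z∈ = x∈p∧x≢y⇒x∈p-y
    (∈N⁺ G (dist≡1⇒~ (trans (sym (d≡ z z≢u (x∈p-y⇒x≢y z∈))) (~⇒dist≡1 u~z))))
    z≢u
    where
    u~z : u ~ z
    u~z = ∈N⁻ G (x∈p-y⇒x∈p z∈)
    z≢u : z ≢ u
    z≢u z≡u = ~-irrefl (sym z≡u) u~z

  dist≡⇒twins : ∀ {u v} → u ≢ v → (∀ z → z ≢ u → z ≢ v → d u z ≡ d v z) →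
                Twins G u v
  dist≡⇒twins u≢v d≡ = u≢v , ⊆-antisym
    (dist≡⇒N-⊆ d≡)
    (dist≡⇒N-⊆ λ z z≢v z≢u → sym (d≡ z z≢u z≢v))

  isTwin⇒∈WTR : ∀ {W x} → WeakTotalResolving G connected W → IsTwin G x → x ∈ W
  isTwin⇒∈WTR {W} {x} (resolving , weakTotal) (v , t@(x≢v , _)) =
    decidable-stable (x ∈? W) λ x∉W →
      let w , w∈W , dx≢dv = resolving x v x≢v
          w≢x : w ≢ x
          w≢x w≡x = x∉W (subst (_∈ W) w≡x w∈W)
          w≡v = decidable-stable (w ≟ v) λ w≢v → dx≢dv (twins⇒dist≡ t w≢x w≢v)
          -- Membership in `W - v` excludes `v`, and `x ∉ W` excludes `x`, so `w′` is a third vertex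
          -- and cannot tell the twins apart.
          w′ , w′∈ , dx≢dv′ = weakTotal v x (subst (_∈ W) w≡v w∈W) x∉W
          w′≢x : w′ ≢ x
          w′≢x w′≡x = x∉W (subst (_∈ W) w′≡x (x∈p-y⇒x∈p w′∈))
      in dx≢dv′ (twins⇒dist≡ t w′≢x (x∈p-y⇒x≢y w′∈))

  ¬isTwin⇒WTR : ∀ {u} → ¬ IsTwin G u → WeakTotalResolving G connected (⊤ - u)
  ¬isTwin⇒WTR {u} ¬twin = resolving , weakTotal
    where
    resolving : Resolving G connected (⊤ - u)
    -- At least one of `y` and `z` differs from `u`, hence lies in `⊤ - u`, and it resolves the pair
    -- itself.
    resolving y z y≢z with y ≟ u
    ... | no y≢u   = y , x∈p∧x≢y⇒x∈p-y ∈⊤ y≢u , dist-separates y≢z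
    ... | yes refl = z , x∈p∧x≢y⇒x∈p-y ∈⊤ (≢-sym y≢z) ,
                     ≢-sym (dist-separates (≢-sym y≢z))

    weakTotal : ∀ w x → w ∈ ⊤ - u → x ∉ ⊤ - u →
                ∃ λ w′ → w′ ∈ ⊤ - u - w × d x w′ ≢ d w w′
    weakTotal w x w∈ x∉ with refl ← x∉⊤-y⇒x≡y x∉ =
      -- Here `x` has become `u`, the only vertex left out. If the finite search for `w′` failed,
      -- every third vertex would be equidistant from `u` and `w`, making `w` a twin of `u`.
      decidable-stable
        (any? λ w′ → (w′ ∈? (⊤ - u - w)) ×-dec ¬? (d u w′ ℕ.≟ d w w′))
        λ ¬separated → ¬twin (w , dist≡⇒twins (≢-sym (x∈p-y⇒x≢y w∈))
          λ z z≢u z≢w → decidable-stable (d u z ℕ.≟ d w z) λ d≢ →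
            ¬separated (z , x∈p∧x≢y⇒x∈p-y (x∈p∧x≢y⇒x∈p-y ∈⊤ z≢u) z≢w , d≢))

  dim-wt≤∣W∣ : ∀ {W} → WeakTotalResolving G connected W → dim-wt G connected ≤ ∣ W ∣
  dim-wt≤∣W∣ {W} wtr = proj₂ (proj₂ (dim-wt-minimum G connected)) ∣ W ∣ (W , wtr , refl)

  dim-wt≤n : dim-wt G connected ≤ n
  dim-wt≤n = subst (dim-wt G connected ≤_) (∣⊤∣≡n n)
    (dim-wt≤∣W∣ (⊤-weakTotalResolving G connected))

  ¬isTwin⇒dim-wt<n : ∀ {u} → ¬ IsTwin G u → dim-wt G connected < n
  ¬isTwin⇒dim-wt<n {u} ¬twin = subst (dim-wt G connected <_) (∣⊤∣≡n n)
    (ℕ.≤-<-trans (dim-wt≤∣W∣ (¬isTwin⇒WTR ¬twin)) (x∈p⇒∣p-x∣<∣p∣ {x = u} ∈⊤))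

  allTwins⇒n≤dim-wt : (∀ u → IsTwin G u) → n ≤ dim-wt G connected
  allTwins⇒n≤dim-wt twin with dim-wt-minimum G connected
  -- Matching turns `dim-wt` into the size of a WTR-set `W` attaining it; all vertices being twins,
  -- `W` contains `⊤`.
  ... | _ , (W , wtr , refl) , _ = subst (_≤ ∣ W ∣) (∣⊤∣≡n n)
    (p⊆q⇒∣p∣≤∣q∣ {p = ⊤} λ {x} _ → isTwin⇒∈WTR wtr (twin x))

theorem4 : ∀ (n : ℕ) → 2 ≤ n → (G : Graph n) (connected : Connected G) →
    (dim-wt G connected ≡ n) ⇔ (∀ u → IsTwin G u)
theorem4 n _ G connected = mk⇔
  (λ dim≡n u → decidable-stable (isTwin? G u) λ ¬twin →
    ℕ.<⇒≢ (¬isTwin⇒dim-wt<n G connected ¬twin) dim≡n)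
  (λ twin → ℕ.≤-antisym (dim-wt≤n G connected) (allTwins⇒n≤dim-wt G connected twin))
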